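{- For any constant $\varepsilon > 0$, there is a polynomial-time randomized algorithm for the All-pair Weighted Distance Preserver problem with approximation ratio $\tilde{O}(n^{1/2+\varepsilon})$, which succeeds in resolving all pairs in $V\times V$ with high probability (that is, with probability at least $1-1/n$).
   Context: **All-pair Weighted Distance Preserver problem.** Instance: a directed simple graph $G=(V,E)$ with $n$ vertices, edge costs $c:E\to\mathbb{Q}_{\ge 0}$, and edge lengths $\ell:E\to\{1,2,3,\dots,\mathrm{poly}(n)\}$ (positive integers bounded by a fixed polynomial in $n$). Objective: find a subgraph $H$ of $G$ of minimum cost such that $d_H(s,t)=d_G(s,t)$ for all $(s,t)\in V\times V$. Here $d_H(s,t)$ is the minimum total length (with respect to $\ell$) of a directed $s\leadsto t$ path in $H$, and the cost of $H$ is $\sum_{e\in E(H)}c(e)$. A pair $(s,t)$ is resolved by $H$ if $d_H(s,t)=d_G(s,t)$. An algorithm has approximation ratio $\rho$ if the cost of its output is at most $\rho$ times the optimal cost. $\tilde{O}(\cdot)$ hides polylogarithmic factors in $n$. -}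

module Defs where

open import Algebra.Definitions.RawMonoid using (sum)
open import Algebra.Definitions.RawSemiring using (_^_)
open import Data.Bool using (Bool; T; if_then_else_)
open import Data.Fin using (Fin; fromℕ<; toℕ; combine; remQuot)
open import Data.Integer as ℤ using (+_)
open import Data.List using (List; []; _∷_; foldr; length)
open import Data.List.Relation.Unary.All using (All)
open import Data.List.Relation.Unary.Unique.Propositional using (Unique)
open import Data.Maybe using (Maybe; just; nothing)
open import Data.Nat as ℕ using (ℕ; suc; _+_; _*_; _∸_; _≤_; NonZero; _≡ᵇ_; _≤ᵇ_; _<ᵇ_)
open import Data.Nat.Logarithm using (⌊log₂_⌋)
open import Data.Nat.Properties using (m^n≢0)
open import Data.Product using (Σ; ∃-syntax; _×_; _,_; uncurry)
open import Data.Rational as ℚ using (ℚ; 0ℚ; 1ℚ)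
open import Data.Vec using (Vec; toList)
open import Relation.Nullary using (¬_; yes; no)
open import Relation.Binary.PropositionalEquality using (_≡_)

infixr 8 _^ℚ_
_^ℚ_ : ℚ → ℕ → ℚ
_^ℚ_ = _^_ ℚ.+-*-rawSemiring

------------------------------------------------------------------------
-- Growth rates

-- Coefficient lists, constant term first.  Coefficients in ℕ suffice
-- because polynomials are only used as upper bounds.
Poly : Set
Poly = List ℕ

⟦_⟧ : Poly → ℕ → ℕ
⟦ p ⟧ x = foldr (λ a y → a + x * y) 0 p

-- f(n) = Õ(n ^ r) for a rational r = a/b ≥ 0 (in lowest terms).  The
-- inequality f(n) ≤ K (log n)^k n^(a/b) is raised to the power b, which
-- is an equivalence as both sides are nonnegative.
Õ[n^_] : ℚ → (ℕ → ℚ) → Set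
Õ[n^ r ] f =
  ∃[ K ] ∃[ k ] ∃[ n₀ ] (∀ n → n₀ ≤ n →
    0ℚ ℚ.≤ f n ×
    f n ^ℚ ℚ.↧ₙ r
      ℚ.≤ + ((K * ⌊log₂ n ⌋ ℕ.^ k) ℕ.^ ℚ.↧ₙ r * n ℕ.^ ℤ.∣ ℚ.↥ r ∣) ℚ./ 1)

------------------------------------------------------------------------
-- Graphs, distances and the problem

-- Adjacency matrix on the vertex set Fin n.  Subgraphs keep all vertices.
EdgeSet : ℕ → Set
EdgeSet n = Fin n → Fin n → Bool

_⊑_ : ∀ {n} → EdgeSet n → EdgeSet n → Set
H ⊑ G = ∀ u v → T (H u v) → T (G u v)

-- Costs and lengths are total functions; their values off E are never used.
record Instance (L : Poly) (n : ℕ) : Set where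
  field
    E        : EdgeSet n
    loopless : ∀ v → ¬ T (E v v)
    c        : Fin n → Fin n → ℚ
    c≥0      : ∀ u v → T (E u v) → 0ℚ ℚ.≤ c u v
    ℓ        : Fin n → Fin n → ℕ
    ℓ≥1      : ∀ u v → T (E u v) → 1 ≤ ℓ u v
    ℓ≤poly   : ∀ u v → T (E u v) → ℓ u v ≤ ⟦ L ⟧ n

-- Vertices may repeat; as lengths are positive, minimum lengths are the
-- same as for paths without repetitions.
data Path {n} (H : EdgeSet n) (ℓ : Fin n → Fin n → ℕ) : Fin n → Fin n → ℕ → Set where
  []  : ∀ {s} → Path H ℓ s s 0
  _∷_ : ∀ {s u t d} → T (H s u) → Path H ℓ u t d → Path H ℓ s t (ℓ s u + d)

-- nothing stands for distance ∞.
IsDist : ∀ {n} → EdgeSet n → (Fin n → Fin n → ℕ) → Fin n → Fin n → Maybe ℕ → Set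
IsDist H ℓ s t (just d) = Path H ℓ s t d × (∀ d′ → Path H ℓ s t d′ → d ≤ d′)
IsDist H ℓ s t nothing  = ∀ d′ → ¬ Path H ℓ s t d′

module _ {L : Poly} {n : ℕ} (I : Instance L n) where
  open Instance I

  Resolves : EdgeSet n → Fin n → Fin n → Set
  Resolves H s t = ∃[ d ] (IsDist H ℓ s t d × IsDist E ℓ s t d)

  ResolvesAll : EdgeSet n → Set
  ResolvesAll H = ∀ s t → Resolves H s t

  cost : EdgeSet n → ℚ
  cost H = sum ℚ.+-0-rawMonoid λ u → sum ℚ.+-0-rawMonoid λ v →
    if H u v then c u v else 0ℚ

  Feasible : EdgeSet n → Set
  Feasible H = H ⊑ E × ResolvesAll H

  Optimal : EdgeSet n → Set
  Optimal H = Feasible H × (∀ H′ → Feasible H′ → cost H ℚ.≤ cost H′)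

------------------------------------------------------------------------
-- Machine model: structured programs for a random access machine with
-- coin flips, under the logarithmic (bit) cost criterion

-- Finitely many unbounded arrays of naturals occur in a program: array
-- names are literals, whereas indices are computed.
Mem : Set
Mem = ℕ → ℕ → ℕ

_[_,_≔_] : Mem → ℕ → ℕ → ℕ → Mem
(σ [ a , i ≔ x ]) b j = if a ≡ᵇ b then (if i ≡ᵇ j then x else σ b j) else σ b j

infixl 7 _⊗_
infixl 6 _⊕_ _⊖_
infix  4 _⊴_
infix  3 _⟨_⟩≔_ _⟨_⟩≔coin
infixr 2 _⨾_

data Expr : Set where
  lit             : ℕ → Expr
  _⟨_⟩            : ℕ → Expr → Expr
  _⊕_ _⊖_ _⊗_ _⊴_ : Expr → Expr → Expr

data Cmd : Set where
  skip         : Cmd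
  _⟨_⟩≔_       : ℕ → Expr → Expr → Cmd
  _⟨_⟩≔coin    : ℕ → Expr → Cmd
  _⨾_          : Cmd → Cmd → Cmd
  if′_then_else_ : Expr → Cmd → Cmd → Cmd
  while_loop_  : Expr → Cmd → Cmd

bits : ℕ → ℕ
bits x = suc ⌊log₂ x ⌋

-- _⊖_ is truncated subtraction and _⊴_ the comparison ≤ with value 0 or 1.
eval : Mem → Expr → ℕ
eval σ (lit k)    = k
eval σ (a ⟨ e ⟩)  = σ a (eval σ e)
eval σ (e₁ ⊕ e₂)  = eval σ e₁ + eval σ e₂
eval σ (e₁ ⊖ e₂)  = eval σ e₁ ∸ eval σ e₂
eval σ (e₁ ⊗ e₂)  = eval σ e₁ * eval σ e₂
eval σ (e₁ ⊴ e₂)  = if eval σ e₁ ≤ᵇ eval σ e₂ then 1 else 0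

-- Array accesses pay for the address as well as the contents;
-- multiplication pays for the schoolbook method.
evalTime : Mem → Expr → ℕ
evalTime σ (lit k)   = bits k
evalTime σ (a ⟨ e ⟩) = evalTime σ e + bits (eval σ e) + bits (eval σ (a ⟨ e ⟩))
evalTime σ (e₁ ⊕ e₂) = evalTime σ e₁ + evalTime σ e₂ + (bits (eval σ e₁) + bits (eval σ e₂))
evalTime σ (e₁ ⊖ e₂) = evalTime σ e₁ + evalTime σ e₂ + (bits (eval σ e₁) + bits (eval σ e₂))
evalTime σ (e₁ ⊗ e₂) = evalTime σ e₁ + evalTime σ e₂ + bits (eval σ e₁) * bits (eval σ e₂)
evalTime σ (e₁ ⊴ e₂) = evalTime σ e₁ + evalTime σ e₂ + (bits (eval σ e₁) + bits (eval σ e₂))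

-- Exec p σ r σ′ r′ t: started in memory σ with coin tosses r, program p
-- halts after time t in memory σ′ with the tosses r′ left unread.
data Exec : Cmd → Mem → List Bool → Mem → List Bool → ℕ → Set where
  skip : ∀ {σ r} → Exec skip σ r σ r 1

  assign : ∀ {a i e σ r} →
    Exec (a ⟨ i ⟩≔ e) σ r (σ [ a , eval σ i ≔ eval σ e ]) r
      (1 + (evalTime σ i + bits (eval σ i)) + (evalTime σ e + bits (eval σ e)))

  coin : ∀ {a i σ b r} →
    Exec (a ⟨ i ⟩≔coin) σ (b ∷ r) (σ [ a , eval σ i ≔ (if b then 1 else 0) ]) r
      (2 + (evalTime σ i + bits (eval σ i)))

  seq : ∀ {p q σ σ′ σ″ r r′ r″ t t′} →
    Exec p σ r σ′ r′ t → Exec q σ′ r′ σ″ r″ t′ →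
    Exec (p ⨾ q) σ r σ″ r″ (1 + t + t′)

  if-nonzero : ∀ {e p q σ σ′ r r′ t} →
    NonZero (eval σ e) → Exec p σ r σ′ r′ t →
    Exec (if′ e then p else q) σ r σ′ r′ (1 + evalTime σ e + t)

  if-zero : ∀ {e p q σ σ′ r r′ t} →
    eval σ e ≡ 0 → Exec q σ r σ′ r′ t →
    Exec (if′ e then p else q) σ r σ′ r′ (1 + evalTime σ e + t)

  while-nonzero : ∀ {e p σ σ′ σ″ r r′ r″ t t′} →
    NonZero (eval σ e) → Exec p σ r σ′ r′ t → Exec (while e loop p) σ′ r′ σ″ r″ t′ →
    Exec (while e loop p) σ r σ″ r″ (1 + evalTime σ e + t + t′)

  while-zero : ∀ {e p σ r} →
    eval σ e ≡ 0 →
    Exec (while e loop p) σ r σ r (1 + evalTime σ e)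

------------------------------------------------------------------------
-- Input and output conventions

-- Row-major layout of an n × n matrix: entry (u , v) at index n * u + v.
rowMajor : ∀ {n} → (Fin n → Fin n → ℕ) → ℕ → ℕ
rowMajor {n} f i with i ℕ.<? n * n
... | yes i<n² = uncurry f (remQuot n (fromℕ< i<n²))
... | no  _    = 0

module _ {L : Poly} {n : ℕ} (I : Instance L n) where
  open Instance I

  -- The entry 0 of the length matrix marks a non-edge.
  inLength inNum inDen : Fin n → Fin n → ℕ
  inLength u v = if E u v then ℓ u v else 0
  inNum    u v = if E u v then ℤ.∣ ℚ.↥ c u v ∣ else 0
  inDen    u v = if E u v then ℚ.↧ₙ c u v else 0

  input : Mem
  input 0 0 = n
  input 1 i = rowMajor inLength i
  input 2 i = rowMajor inNum i
  input 3 i = rowMajor inDen i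
  input _ _ = 0

  size : ℕ
  size = bits n +
    sum ℕ.+-0-rawMonoid λ u → sum ℕ.+-0-rawMonoid λ v →
      bits (inLength u v) + bits (inNum u v) + bits (inDen u v)

-- The output is the n × n matrix in array 4, nonzero entries being edges.
output : ∀ n → Mem → EdgeSet n
output n σ u v = 0 <ᵇ σ 4 (toℕ (combine u v))

------------------------------------------------------------------------
-- Randomized approximation algorithms

record Run (p : Cmd) (σ : Mem) (r : List Bool) : Set where
  field
    {final}  : Mem
    {unread} : List Bool
    {time}   : ℕ
    exec     : Exec p σ r final unread time

-- Pr[A] ≥ q over m independent fair coins: some list of distinct outcomes
-- in A has at least q * 2 ^ m members.
ProbAtLeast : ∀ m → ℚ → (Vec Bool m → Set) → Set
ProbAtLeast m q A =
  Σ (List (Vec Bool m)) λ rs → Unique rs × All A rs ×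
    q ℚ.≤ (+ length rs ℚ./ (2 ℕ.^ m)) {{m^n≢0 2 m}}

-- Each coin costs at least one time step, so the time bound is also a
-- sufficient supply of coins; unread coins do not affect probabilities.
record WHPApproxAlgorithm (L : Poly) (ρ : ℕ → ℚ) : Set where
  field
    program   : Cmd
    timeBound : Poly

  coins : ∀ {n} → Instance L n → ℕ
  coins I = ⟦ timeBound ⟧ (size I)

  field
    run : ∀ {n} .{{_ : NonZero n}} (I : Instance L n) (r : Vec Bool (coins I)) →
          Run program (input I) (toList r)

  result : ∀ {n} .{{_ : NonZero n}} (I : Instance L n) → Vec Bool (coins I) → EdgeSet n
  result {n} I r = output n (Run.final (run I r))

  field
    polytime : ∀ {n} .{{_ : NonZero n}} (I : Instance L n) r →
               Run.time (run I r) ≤ ⟦ timeBound ⟧ (size I)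
    subgraph : ∀ {n} .{{_ : NonZero n}} (I : Instance L n) r →
               result I r ⊑ Instance.E I
    ratio    : ∀ {n} .{{_ : NonZero n}} (I : Instance L n) r →
               ∀ H* → Optimal I H* → cost I (result I r) ℚ.≤ ρ n ℚ.* cost I H*
    success  : ∀ {n} .{{_ : NonZero n}} (I : Instance L n) →
               ProbAtLeast (coins I) (1ℚ ℚ.- + 1 ℚ./ n) (λ r → ResolvesAll I (result I r))

{-# OPTIONS --safe #-}

-- As lengths are positive, the problem has a least solution: an edge (u , v)
-- is redundant iff G has a detour, i.e. a walk from u to v with at least two
-- edges and length at most ℓ u v.  An edge without detour is the only shortest
-- path between its ends, so it belongs to every preserver.  Conversely the
-- edges of a detour of e are strictly shorter than e, so by induction on
-- length detours can be replaced by walks of edges without detour.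
-- Floyd-Warshall finds these edges deterministically, so the ratio is 1 and
-- no coin is tossed.

module Submission where

open import Defs
open import Algebra.Definitions.RawMonoid using (sum)
open import Data.Bool using (Bool; true; false; T; if_then_else_)
open import Data.Empty using (⊥; ⊥-elim)
open import Data.Fin using (Fin; zero; suc; toℕ; fromℕ<; combine; remQuot)
open import Data.Fin.Properties using (toℕ<n; toℕ-injective; toℕ-fromℕ<; fromℕ<-toℕ; toℕ-combine; combine-injective; remQuot-combine) renaming (_≟_ to _≟ᶠ_)
open import Data.Integer as ℤ using (+_)
import Data.Integer.Properties as ℤₚ
open import Data.List using (List; []; _∷_; _++_; length; map)
open import Data.List.Membership.Propositional using (_∈_)
open import Data.List.Membership.Propositional.Properties using (∈-map⁻)
open import Data.List.Properties using (length-++; length-map)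
open import Data.List.Relation.Unary.All using ([]; _∷_; universal)
open import Data.List.Relation.Unary.AllPairs using ([]; _∷_)
open import Data.List.Relation.Unary.Unique.Propositional using (Unique)
open import Data.List.Relation.Unary.Unique.Propositional.Properties using (map⁺; ++⁺)
open import Data.Maybe using (just; nothing)
open import Data.Nat using (ℕ; zero; suc; _+_; _*_; _^_; _≤_; _<_; _<ᵇ_; _≡ᵇ_; _≤ᵇ_; +-0-rawMonoid; z≤n; s≤s; z<s; NonZero; >-nonZero)
open import Data.Nat.Logarithm using (⌊log₂_⌋; ⌊log₂⌋-mono-≤; ⌊log₂[2^n]⌋≡n)
open import Data.Nat.Properties
open import Data.Nat.Solver using (module +-*-Solver)
open import Data.Product using (Σ; ∃-syntax; _×_; _,_; proj₁; proj₂; uncurry)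
open import Data.Rational as ℚ using (ℚ; Positive; ½; 1ℚ)
import Data.Rational.Properties as ℚₚ
open import Data.Rational.Unnormalised as ℚᵘ using ()
import Data.Rational.Unnormalised.Properties as ℚᵘₚ
open import Data.Sum using (_⊎_; inj₁; inj₂; [_,_]′)
open import Data.Unit using (⊤; tt)
open import Data.Vec using (Vec; []; _∷_; toList)
open import Data.Vec.Properties using (∷-injectiveʳ)
open import Relation.Binary.PropositionalEquality
open import Relation.Nullary using (¬_; yes; no)
open +-*-Solver using (solve; _:+_; _:*_; _:=_)
open import Data.Product using (Σ; ∃; ∃-syntax; _×_; _,_; proj₁; proj₂; uncurry)
open import Data.Rational using (ℚ; Positive; ½) renaming (_+_ to _+ℚ_)
open import Data.Sum using (_⊎_; inj₁; inj₂; [_,_]′)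
open import Data.Unit using (⊤; tt)
open import Relation.Binary.PropositionalEquality
open import Relation.Nullary using (¬_; yes; no)

-- Polynomially bounded functions

-- The obstacle is ties. Distances alone do not decide which edges to keep: an edge must also go
-- when a detour is exactly as long as the edge. Hence relaxation happens on `≤` rather than `<`,
-- and each relaxation clears the output flag of its entry. With the customary zero diagonal, a
-- pivot `u` would tie with every entry of row `u` and clear all its flags; therefore only walks
-- with at least one edge are measured, and the diagonal starts at ∞ like any other non-edge. For
-- the running time, every value that the program reads is at most some `V` polynomial in `n`. The
-- time is then bounded by recursion on the program text, with `V` bounding each array read and the
-- iterations of each loop.

PolyBounded : (ℕ → ℕ) → Set
PolyBounded f = Σ Poly λ p → ∀ x → f x ≤ ⟦ p ⟧ x

_+ᴾ_ : Poly → Poly → Poly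
[]      +ᴾ q       = q
(a ∷ p) +ᴾ []      = a ∷ p
(a ∷ p) +ᴾ (b ∷ q) = a + b ∷ p +ᴾ q

_*ᴾ_ : Poly → Poly → Poly
[]      *ᴾ q = []
(a ∷ p) *ᴾ q = map (a *_) q +ᴾ (0 ∷ p *ᴾ q)

⟦+ᴾ⟧ : ∀ p q x → ⟦ p +ᴾ q ⟧ x ≡ ⟦ p ⟧ x + ⟦ q ⟧ x
⟦+ᴾ⟧ []      q       x = refl
⟦+ᴾ⟧ (a ∷ p) []      x = sym (+-identityʳ _)
⟦+ᴾ⟧ (a ∷ p) (b ∷ q) x rewrite ⟦+ᴾ⟧ p q x =
  solve 5 (λ a b x p q → a :+ b :+ x :* (p :+ q) := a :+ x :* p :+ (b :+ x :* q))
    refl a b x (⟦ p ⟧ x) (⟦ q ⟧ x)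

⟦map*⟧ : ∀ a p x → ⟦ map (a *_) p ⟧ x ≡ a * ⟦ p ⟧ x
⟦map*⟧ a []      x = sym (*-zeroʳ a)
⟦map*⟧ a (b ∷ p) x rewrite ⟦map*⟧ a p x =
  solve 4 (λ a b x p → a :* b :+ x :* (a :* p) := a :* (b :+ x :* p)) refl a b x (⟦ p ⟧ x)

⟦*ᴾ⟧ : ∀ p q x → ⟦ p *ᴾ q ⟧ x ≡ ⟦ p ⟧ x * ⟦ q ⟧ x
⟦*ᴾ⟧ []      q x = refl
⟦*ᴾ⟧ (a ∷ p) q x
  rewrite ⟦+ᴾ⟧ (map (a *_) q) (0 ∷ p *ᴾ q) x | ⟦map*⟧ a q x | ⟦*ᴾ⟧ p q x =
  solve 4 (λ a x p q → a :* q :+ x :* (p :* q) := (a :+ x :* p) :* q)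
    refl a x (⟦ p ⟧ x) (⟦ q ⟧ x)

⟦⟧-mono-≤ : ∀ p {x y} → x ≤ y → ⟦ p ⟧ x ≤ ⟦ p ⟧ y
⟦⟧-mono-≤ []      x≤y = z≤n
⟦⟧-mono-≤ (a ∷ p) x≤y = +-monoʳ-≤ a (*-mono-≤ x≤y (⟦⟧-mono-≤ p x≤y))

poly-bounded : ∀ p → PolyBounded ⟦ p ⟧
poly-bounded p = p , λ _ → ≤-refl

const-bounded : ∀ k → PolyBounded (λ _ → k)
const-bounded k = k ∷ [] , λ x → m≤m+n k (x * 0)

id-bounded : PolyBounded (λ x → x)
id-bounded = 0 ∷ 1 ∷ [] , λ x →
  ≤-reflexive (sym (trans (cong (x *_) (cong suc (*-zeroʳ x))) (*-identityʳ x)))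

infixl 6 _+ᵇ_
infixl 7 _*ᵇ_

_+ᵇ_ : ∀ {f g} → PolyBounded f → PolyBounded g → PolyBounded (λ x → f x + g x)
(p , f≤p) +ᵇ (q , g≤q) = p +ᴾ q , λ x →
  ≤-trans (+-mono-≤ (f≤p x) (g≤q x)) (≤-reflexive (sym (⟦+ᴾ⟧ p q x)))

_*ᵇ_ : ∀ {f g} → PolyBounded f → PolyBounded g → PolyBounded (λ x → f x * g x)
(p , f≤p) *ᵇ (q , g≤q) = p *ᴾ q , λ x →
  ≤-trans (*-mono-≤ (f≤p x) (g≤q x)) (≤-reflexive (sym (⟦*ᴾ⟧ p q x)))

suc-bounded : ∀ {f} → PolyBounded f → PolyBounded (λ x → suc (f x))
suc-bounded b = const-bounded 1 +ᵇ b

-- Running time of programs on memories with bounded entries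

-- Deliberately crude: a linear bound in place of the logarithm keeps all time bounds within `Poly`.
bits≤suc : ∀ {x y} → x ≤ y → bits x ≤ suc y
bits≤suc {x} {y} x≤y = s≤s (begin
  ⌊log₂ x ⌋             ≤⟨ ⌊log₂⌋-mono-≤ (≤-trans x≤y (<⇒≤ (n<2^n y))) ⟩
  ⌊log₂ 2 ^ y ⌋         ≡⟨ ⌊log₂[2^n]⌋≡n y ⟩
  y                     ∎)
  where
  open ≤-Reasoning
  n<2^n : ∀ n → n < 2 ^ n
  n<2^n zero    = z<s
  n<2^n (suc n) = begin
    suc (suc n)     ≤⟨ +-mono-≤ (≤-trans (s≤s z≤n) (n<2^n n)) (n<2^n n) ⟩
    2 ^ n + 2 ^ n   ≡⟨ cong (_+_ (2 ^ n)) (sym (+-identityʳ (2 ^ n))) ⟩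
    2 ^ suc n       ∎

-- The numerators and denominators of the costs, in arrays 2 and 3, are
-- not bounded by a polynomial in the size of the input.
Bounded : ℕ → Set
Bounded 2 = ⊥
Bounded 3 = ⊥
Bounded _ = ⊤

-- For a concrete expression this computes to a product of `⊤`, which is why `_` proves it in most
-- uses.
Reads : Expr → Set
Reads (lit k)   = ⊤
Reads (a ⟨ e ⟩) = Bounded a × Reads e
Reads (e ⊕ f)   = Reads e × Reads f
Reads (e ⊖ f)   = Reads e × Reads f
Reads (e ⊗ f)   = Reads e × Reads f
Reads (e ⊴ f)   = Reads e × Reads f

-- Worst-case values and times, obtained from the syntax alone by counting every array read as `V`.
-- For a fixed program the result is a polynomial in `V`.
module Bound (V : ℕ) where

  value : Expr → ℕ
  value (lit k)   = k
  value (a ⟨ e ⟩) = V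
  value (e ⊕ f)   = value e + value f
  value (e ⊖ f)   = value e
  value (e ⊗ f)   = value e * value f
  value (e ⊴ f)   = 1

  exprTime : Expr → ℕ
  exprTime (lit k)   = suc k
  exprTime (a ⟨ e ⟩) = exprTime e + suc (value e) + suc V
  exprTime (e ⊕ f)   = exprTime e + exprTime f + (suc (value e) + suc (value f))
  exprTime (e ⊖ f)   = exprTime e + exprTime f + (suc (value e) + suc (value f))
  exprTime (e ⊗ f)   = exprTime e + exprTime f + suc (value e) * suc (value f)
  exprTime (e ⊴ f)   = exprTime e + exprTime f + (suc (value e) + suc (value f))

  -- Valid for programs that toss no coins and leave each loop after at
  -- most V iterations.
  cmdTime : Cmd → ℕ
  cmdTime skip                   = 1
  cmdTime (a ⟨ i ⟩≔ e)           = 1 + (exprTime i + suc (value i)) + (exprTime e + suc (value e))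
  cmdTime (a ⟨ i ⟩≔coin)         = 0
  cmdTime (p ⨾ q)                = 1 + cmdTime p + cmdTime q
  cmdTime (if′ e then p else q)  = 1 + exprTime e + (cmdTime p + cmdTime q)
  cmdTime (while e loop p)       = suc V * (1 + exprTime e + cmdTime p)

module _ {V : ℕ → ℕ} (bV : PolyBounded V) where

  value-bounded : ∀ e → PolyBounded (λ x → Bound.value (V x) e)
  value-bounded (lit k)   = const-bounded k
  value-bounded (a ⟨ e ⟩) = bV
  value-bounded (e ⊕ f)   = value-bounded e +ᵇ value-bounded f
  value-bounded (e ⊖ f)   = value-bounded e
  value-bounded (e ⊗ f)   = value-bounded e *ᵇ value-bounded f
  value-bounded (e ⊴ f)   = const-bounded 1

  sucValue-bounded : ∀ e → PolyBounded (λ x → suc (Bound.value (V x) e))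
  sucValue-bounded e = suc-bounded (value-bounded e)

  exprTime-bounded : ∀ e → PolyBounded (λ x → Bound.exprTime (V x) e)
  exprTime-bounded (lit k)   = const-bounded (suc k)
  exprTime-bounded (a ⟨ e ⟩) = exprTime-bounded e +ᵇ sucValue-bounded e +ᵇ suc-bounded bV
  exprTime-bounded (e ⊕ f)   = exprTime-bounded e +ᵇ exprTime-bounded f +ᵇ (sucValue-bounded e +ᵇ sucValue-bounded f)
  exprTime-bounded (e ⊖ f)   = exprTime-bounded e +ᵇ exprTime-bounded f +ᵇ (sucValue-bounded e +ᵇ sucValue-bounded f)
  exprTime-bounded (e ⊗ f)   = exprTime-bounded e +ᵇ exprTime-bounded f +ᵇ sucValue-bounded e *ᵇ sucValue-bounded f
  exprTime-bounded (e ⊴ f)   = exprTime-bounded e +ᵇ exprTime-bounded f +ᵇ (sucValue-bounded e +ᵇ sucValue-bounded f)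

  cmdTime-bounded : ∀ p → PolyBounded (λ x → Bound.cmdTime (V x) p)
  cmdTime-bounded skip = const-bounded 1
  cmdTime-bounded (a ⟨ i ⟩≔ e) =
    const-bounded 1 +ᵇ (exprTime-bounded i +ᵇ sucValue-bounded i) +ᵇ (exprTime-bounded e +ᵇ sucValue-bounded e)
  cmdTime-bounded (a ⟨ i ⟩≔coin) = const-bounded 0
  cmdTime-bounded (p ⨾ q) = const-bounded 1 +ᵇ cmdTime-bounded p +ᵇ cmdTime-bounded q
  cmdTime-bounded (if′ e then p else q) =
    const-bounded 1 +ᵇ exprTime-bounded e +ᵇ (cmdTime-bounded p +ᵇ cmdTime-bounded q)
  cmdTime-bounded (while e loop p) =
    suc-bounded bV *ᵇ (const-bounded 1 +ᵇ exprTime-bounded e +ᵇ cmdTime-bounded p)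

-- Program logic

for_loop_ : ℕ → Cmd → Cmd
for x loop p =
  x ⟨ lit 0 ⟩≔ lit 0 ⨾
  (while lit 1 ⊕ x ⟨ lit 0 ⟩ ⊴ 0 ⟨ lit 0 ⟩ loop
    (p ⨾ (x ⟨ lit 0 ⟩≔ x ⟨ lit 0 ⟩ ⊕ lit 1)))

-- Array names are literals, so an update of array `x` reduces away wherever another array is read.
-- The concrete instances below are therefore identity functions.
Ignores : ℕ → (Mem → Set) → Set
Ignores x P = ∀ {σ y} → P σ → P (σ [ x , 0 ≔ y ])

read-same : ∀ σ a i x → (σ [ a , i ≔ x ]) a i ≡ x
read-same σ a i x with a ≡ᵇ a | ≡⇒≡ᵇ a a refl | i ≡ᵇ i | ≡⇒≡ᵇ i i refl
... | true | _ | true | _ = refl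

module Logic (n V : ℕ) (n≤V : n ≤ V) where
  open Bound V

  record Valid (σ : Mem) : Set where
    constructor valid
    field
      order : σ 0 0 ≡ n
      bound : ∀ a i → Bounded a → σ a i ≤ V
  open Valid

  value-≤ : ∀ {σ} → Valid σ → ∀ e → Reads e → eval σ e ≤ value e
  value-≤ v (lit k)   r       = ≤-refl
  value-≤ v (a ⟨ e ⟩) (r , s) = bound v a _ r
  value-≤ v (e ⊕ f)   (r , s) = +-mono-≤ (value-≤ v e r) (value-≤ v f s)
  value-≤ {σ} v (e ⊖ f)   (r , s) = ≤-trans (m∸n≤m (eval σ e) (eval σ f)) (value-≤ v e r)
  value-≤ v (e ⊗ f)   (r , s) = *-mono-≤ (value-≤ v e r) (value-≤ v f s)
  value-≤ {σ} v (e ⊴ f)   (r , s) with eval σ e ≤ᵇ eval σ f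
  ... | true  = ≤-refl
  ... | false = z≤n

  bits-≤ : ∀ {σ} → Valid σ → ∀ e → Reads e → bits (eval σ e) ≤ suc (value e)
  bits-≤ v e r = bits≤suc (value-≤ v e r)

  exprTime-≤ : ∀ {σ} → Valid σ → ∀ e → Reads e → evalTime σ e ≤ exprTime e
  exprTime-≤ v (lit k)   r       = bits≤suc {k} ≤-refl
  exprTime-≤ v (a ⟨ e ⟩) (r , s) =
    +-mono-≤ (+-mono-≤ (exprTime-≤ v e s) (bits-≤ v e s)) (bits≤suc (bound v a _ r))
  exprTime-≤ v (e ⊕ f)   (r , s) =
    +-mono-≤ (+-mono-≤ (exprTime-≤ v e r) (exprTime-≤ v f s)) (+-mono-≤ (bits-≤ v e r) (bits-≤ v f s))
  exprTime-≤ v (e ⊖ f)   (r , s) =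
    +-mono-≤ (+-mono-≤ (exprTime-≤ v e r) (exprTime-≤ v f s)) (+-mono-≤ (bits-≤ v e r) (bits-≤ v f s))
  exprTime-≤ v (e ⊗ f)   (r , s) =
    +-mono-≤ (+-mono-≤ (exprTime-≤ v e r) (exprTime-≤ v f s)) (*-mono-≤ (bits-≤ v e r) (bits-≤ v f s))
  exprTime-≤ v (e ⊴ f)   (r , s) =
    +-mono-≤ (+-mono-≤ (exprTime-≤ v e r) (exprTime-≤ v f s)) (+-mono-≤ (bits-≤ v e r) (bits-≤ v f s))

  -- Total correctness together with a time bound. In `exec` the tosses `r` come out as they went
  -- in, so that one final memory serves all outcomes of the coins.
  record Reaches (p : Cmd) (T : ℕ) (σ : Mem) (Q : Mem → Set) : Set where
    constructor reaches
    field
      {final} : Mem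
      {time}  : ℕ
      isValid : Valid final
      post    : Q final
      time≤   : time ≤ T
      exec    : ∀ r → Exec p σ r final r time

  WP : Cmd → Mem → (Mem → Set) → Set
  WP p = Reaches p (cmdTime p)

  wp-skip : ∀ {σ} {Q : Mem → Set} → Valid σ → Q σ → WP skip σ Q
  wp-skip v q = reaches v q ≤-refl λ _ → skip

  -- Writing only to arrays `suc a` protects array 0, whose entry `n` bounds every loop. Accordingly
  -- the argument 3 or 7 of `wp-assign` stands for array 4 or 8.
  valid-update : ∀ {σ} → Valid σ → ∀ a i {x} → x ≤ V → Valid (σ [ suc a , i ≔ x ])
  valid-update v a i x≤V .order = order v
  valid-update v a i x≤V .bound b j r with suc a ≡ᵇ b | i ≡ᵇ j
  ... | true  | true  = x≤V
  ... | true  | false = bound v b j r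
  ... | false | _     = bound v b j r

  wp-assign : ∀ {σ} {Q : Mem → Set} a i e → Valid σ → Reads i → Reads e →
    eval σ e ≤ V → Q (σ [ suc a , eval σ i ≔ eval σ e ]) →
    WP (suc a ⟨ i ⟩≔ e) σ Q
  wp-assign {σ} a i e v ri re e≤V q = reaches (valid-update v a (eval σ i) e≤V) q
    (+-mono-≤ (s≤s (+-mono-≤ (exprTime-≤ v i ri) (bits-≤ v i ri)))
              (+-mono-≤ (exprTime-≤ v e re) (bits-≤ v e re)))
    λ _ → assign

  wp-seq : ∀ {p q T U σ} {P Q : Mem → Set} → Reaches p T σ P →
    (∀ {σ′} → Valid σ′ → P σ′ → Reaches q U σ′ Q) → Reaches (p ⨾ q) (1 + T + U) σ Q
  wp-seq (reaches v P t≤ e) k with k v P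
  ... | reaches v′ Q t′≤ e′ = reaches v′ Q (s≤s (+-mono-≤ t≤ t′≤)) λ r → seq (e r) (e′ r)

  wp-if : ∀ {σ} {Q : Mem → Set} e {p q} → Valid σ → Reads e →
    (NonZero (eval σ e) → WP p σ Q) → (eval σ e ≡ 0 → WP q σ Q) →
    WP (if′ e then p else q) σ Q
  wp-if {σ} {Q} e {p} {q} v re nz z = go _ refl
    where
    go : ∀ x → eval σ e ≡ x → WP (if′ e then p else q) σ Q
    go zero eq with z eq
    ... | reaches v′ Q t≤ ex =
      reaches v′ Q (s≤s (+-mono-≤ (exprTime-≤ v e re) (≤-trans t≤ (m≤n+m _ _)))) λ r → if-zero eq (ex r)
    go (suc x) eq with nz (subst NonZero (sym eq) _)
    ... | reaches v′ Q t≤ ex =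
      reaches v′ Q (s≤s (+-mono-≤ (exprTime-≤ v e re) (≤-trans t≤ (m≤m+n _ _))))
        λ r → if-nonzero (subst NonZero (sym eq) _) (ex r)

  eval-⊴ : ∀ σ e f → eval σ e ≤ eval σ f → NonZero (eval σ (e ⊴ f))
  eval-⊴ σ e f e≤f with eval σ e ≤ᵇ eval σ f | ≤⇒≤ᵇ e≤f
  ... | true | _ = _

  eval-⋬ : ∀ σ e f → eval σ f < eval σ e → eval σ (e ⊴ f) ≡ 0
  eval-⋬ σ e f f<e with eval σ e ≤ᵇ eval σ f | ≤ᵇ⇒≤ (eval σ e) (eval σ f)
  ... | true  | e≤f = ⊥-elim (<⇒≱ f<e (e≤f tt))
  ... | false | _   = refl

  nonZero-⊴ : ∀ σ e f → NonZero (eval σ (e ⊴ f)) → eval σ e ≤ eval σ f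
  nonZero-⊴ σ e f nz with eval σ e ≤ᵇ eval σ f | ≤ᵇ⇒≤ (eval σ e) (eval σ f)
  ... | true | e≤f = e≤f tt

  zero-⊴ : ∀ σ e f → eval σ (e ⊴ f) ≡ 0 → eval σ f < eval σ e
  zero-⊴ σ e f eq with eval σ e ≤ᵇ eval σ f | ≤⇒≤ᵇ {eval σ e} {eval σ f}
  ... | false | ¬e≤f = ≰⇒> ¬e≤f

  module _ (x : ℕ) (bx : Bounded (suc x)) (Inv : ℕ → Mem → Set)
    (ignores : ∀ {i} → Ignores (suc x) (Inv i)) {p : Cmd}
    (step : ∀ (i : Fin n) {σ} → Valid σ → Inv (toℕ i) σ → σ (suc x) 0 ≡ toℕ i →
            WP p σ λ σ′ → Inv (suc (toℕ i)) σ′ × σ′ (suc x) 0 ≡ toℕ i)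
    where

    private
      X    = suc x
      test = lit 1 ⊕ X ⟨ lit 0 ⟩ ⊴ 0 ⟨ lit 0 ⟩
      body = p ⨾ (X ⟨ lit 0 ⟩≔ X ⟨ lit 0 ⟩ ⊕ lit 1)
      pass = 1 + exprTime test + cmdTime body

      reads-test : Reads test
      reads-test = (_ , bx , _) , _ , _

    -- Induction on the number `m` of iterations left. The extra pass in `suc m` pays for the final,
    -- failing test.
    wp-while : ∀ m i → i + m ≡ n → ∀ {σ} → Valid σ → Inv i σ → σ X 0 ≡ i →
      Reaches (while test loop body) (suc m * pass) σ (Inv n)
    wp-while zero i i≡n {σ} v inv x≡i rewrite +-identityʳ i | i≡n = reaches v inv
      (≤-trans (s≤s (exprTime-≤ v test reads-test)) (≤-trans (m≤m+n _ _) (m≤m+n _ _)))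
      λ r → while-zero (eval-⋬ σ (lit 1 ⊕ X ⟨ lit 0 ⟩) (0 ⟨ lit 0 ⟩)
        (subst₂ (λ a b → a < 1 + b) (sym (order v)) (sym x≡i) ≤-refl))
    wp-while (suc m) i i+m≡n {σ} v inv x≡i = continue bodyWP
      where
      i<n : i < n
      i<n = subst (suc i ≤_) (trans (sym (+-suc i m)) i+m≡n) (m≤m+n (suc i) m)
      j = fromℕ< i<n
      j≡i : toℕ j ≡ i
      j≡i = toℕ-fromℕ< i<n

      bodyWP : WP body σ λ σ′ → Inv (suc i) σ′ × σ′ X 0 ≡ suc i
      bodyWP = wp-seq
        (step j v (subst (λ k → Inv k σ) (sym j≡i) inv) (trans x≡i (sym j≡i)))
        λ {σ′} v′ (inv′ , x≡j) →
          let x+1≡ : σ′ X 0 + 1 ≡ suc i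
              x+1≡ = trans (+-comm _ 1) (cong suc (trans x≡j j≡i)) in
          wp-assign x (lit 0) (X ⟨ lit 0 ⟩ ⊕ lit 1) v′ _ ((bx , _) , _)
            (≤-trans (≤-trans (≤-reflexive x+1≡) i<n) n≤V)
            (ignores (subst (λ k → Inv (suc k) σ′) j≡i inv′) ,
             trans (read-same σ′ X 0 _) x+1≡)

      continue : WP body σ (λ σ′ → Inv (suc i) σ′ × σ′ X 0 ≡ suc i) →
        Reaches (while test loop body) (suc (suc m) * pass) σ (Inv n)
      continue (reaches v′ (inv′ , x≡′) t≤ ex)
        with wp-while m (suc i) (trans (sym (+-suc i m)) i+m≡n) v′ inv′ x≡′
      ... | reaches v″ q t′≤ ex′ = reaches v″ q
        (+-mono-≤ (s≤s (+-mono-≤ (exprTime-≤ v test reads-test) t≤)) t′≤)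
        λ r → while-nonzero
          (eval-⊴ σ (lit 1 ⊕ X ⟨ lit 0 ⟩) (0 ⟨ lit 0 ⟩)
            (subst₂ (λ a b → 1 + a ≤ b) (sym x≡i) (sym (order v)) i<n))
          (ex r) (ex′ r)

    wp-for : ∀ {σ} → Valid σ → Inv 0 σ → WP (for X loop p) σ (Inv n)
    wp-for {σ} v inv = wp-seq
      (wp-assign {Q = λ σ′ → Inv 0 σ′ × σ′ X 0 ≡ 0} x (lit 0) (lit 0) v _ _ z≤n
        (ignores inv , read-same σ X 0 0))
      λ v′ (inv′ , x≡0) → weaken (wp-while n 0 refl v′ inv′ x≡0)
      where
      weaken : ∀ {σ′} → Reaches (while test loop body) (suc n * pass) σ′ (Inv n) →
        WP (while test loop body) σ′ (Inv n)
      weaken (reaches v q t≤ ex) = reaches v q (≤-trans t≤ (*-monoˡ-≤ pass (s≤s n≤V))) ex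

  wp-mono : ∀ {p T σ} {P Q : Mem → Set} → (∀ {σ′} → P σ′ → Q σ′) → Reaches p T σ P → Reaches p T σ Q
  wp-mono P⇒Q (reaches v p t≤ ex) = reaches v (P⇒Q p) t≤ ex

  below-suc : ∀ {P : Fin n → Set} {i : Fin n} →
    (∀ p → toℕ p < toℕ i → P p) → P i → ∀ p → toℕ p < suc (toℕ i) → P p
  below-suc {i = i} below at p p<1+i with m<1+n⇒m<n∨m≡n p<1+i
  ... | inj₁ p<i = below p p<i
  ... | inj₂ p≡i with toℕ-injective p≡i
  ...   | refl = at

  module _ (G : Mem → Set) (Q : Fin n → Fin n → Mem → Set)
    (G⊥6 : Ignores 6 G) (G⊥7 : Ignores 7 G)
    (Q⊥6 : ∀ {p q} → Ignores 6 (Q p q)) (Q⊥7 : ∀ {p q} → Ignores 7 (Q p q)) {c : Cmd}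
    (cell : ∀ u v {σ} → Valid σ → G σ → σ 6 0 ≡ toℕ u → σ 7 0 ≡ toℕ v →
      WP c σ λ σ′ → G σ′ × σ′ 6 0 ≡ toℕ u × σ′ 7 0 ≡ toℕ v ×
        (∀ p q → Q p q σ → Q p q σ′) × Q u v σ′)
    where

    private
      Rows : ℕ → Mem → Set
      Rows i σ = G σ × ∀ p → toℕ p < i → ∀ q → Q p q σ

      Cells : Fin n → ℕ → Mem → Set
      Cells u j σ = Rows (toℕ u) σ × σ 6 0 ≡ toℕ u × ∀ q → toℕ q < j → Q u q σ

      row : ∀ u {σ} → Valid σ → Rows (toℕ u) σ → σ 6 0 ≡ toℕ u →
        WP (for 7 loop c) σ λ σ′ → Rows (suc (toℕ u)) σ′ × σ′ 6 0 ≡ toℕ u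
      row u vσ rows ≡u = wp-mono
        (λ ((g , rs) , ≡u , cs) → (g , below-suc rs λ q → cs q (toℕ<n q)) , ≡u)
        (wp-for 6 _ (Cells u)
          (λ ((g , rs) , ≡u , cs) →
            (G⊥7 g , λ p l q → Q⊥7 (rs p l q)) , ≡u , λ q l → Q⊥7 (cs q l))
          (λ v vσ ((g , rs) , ≡u , cs) ≡v → wp-mono
            (λ (g′ , ≡u′ , ≡v′ , keep , new) →
              ((g′ , λ p l q → keep p q (rs p l q)) , ≡u′ ,
               below-suc (λ q l → keep u q (cs q l)) new) , ≡v′)
            (cell u v vσ g ≡u ≡v))
          vσ (rows , ≡u , λ _ ()))

    -- One rule for both the initialization and the relaxation by a pivot. `G` holds throughout;
    -- `Q u v` is established by the visit to cell (u , v), and every later visit has to preserve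
    -- it.
    wp-for² : ∀ {σ} → Valid σ → G σ →
      WP (for 6 loop for 7 loop c) σ λ σ′ → G σ′ × ∀ p q → Q p q σ′
    wp-for² v g = wp-mono (λ (g , rs) → g , λ p → rs p (toℕ<n p))
      (wp-for 5 _ Rows
        (λ (g , rs) → G⊥6 g , λ p l q → Q⊥6 (rs p l q))
        row v (g , λ _ ()))

-- Walks and detours

module Distances {L : Poly} {n : ℕ} (I : Instance L n) where
  open Instance I

  -- Walks with at least one edge whose interior vertices are below k.
  data Walk (k : ℕ) : Fin n → Fin n → ℕ → Set where
    edge : ∀ {u v} → T (E u v) → Walk k u v (ℓ u v)
    step : ∀ {u w v d} → T (E u w) → toℕ w < k → Walk k w v d → Walk k u v (ℓ u w + d)

  walk-positive : ∀ {k u v d} → Walk k u v d → 1 ≤ d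
  walk-positive (edge e)     = ℓ≥1 _ _ e
  walk-positive (step e _ _) = ≤-trans (ℓ≥1 _ _ e) (m≤m+n _ _)

  walk-suc : ∀ {k u v d} → Walk k u v d → Walk (suc k) u v d
  walk-suc (edge e)     = edge e
  walk-suc (step e l p) = step e (m<n⇒m<1+n l) (walk-suc p)

  walk-++ : ∀ {k u w v d d′} → Walk k u w d → toℕ w < k → Walk k w v d′ → Walk k u v (d + d′)
  walk-++ (edge e) l q = step e l q
  walk-++ {d′ = d′} (step {u} {w} {d = d} e l′ p) l q =
    subst (Walk _ _ _) (sym (+-assoc (ℓ u w) d d′)) (step e l′ (walk-++ p l q))

  walk⇒path : ∀ {k u v d} → Walk k u v d → Path E ℓ u v d
  walk⇒path (edge e)     = subst (Path E ℓ _ _) (+-identityʳ _) (e ∷ [])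
  walk⇒path (step e _ p) = e ∷ walk⇒path p

  edge∷path⇒walk : ∀ {u w v d} → T (E u w) → Path E ℓ w v d → Walk n u v (ℓ u w + d)
  edge∷path⇒walk e []      = subst (Walk n _ _) (sym (+-identityʳ _)) (edge e)
  edge∷path⇒walk e (f ∷ p) = step e (toℕ<n _) (edge∷path⇒walk f p)

  Through : ℕ → Fin n → Fin n → Fin n → ℕ → Set
  Through k w u v d = ∃[ a ] ∃[ b ] Walk k u w a × Walk k w v b × a + b ≤ d

  -- The parts before the first and after the last visit of w.
  split : ∀ {k} w → toℕ w ≡ k → ∀ {u v d} → Walk (suc k) u v d → Walk k u v d ⊎ Through k w u v d
  -- The first edge is kept apart because `Complete` concerns walks with at least two edges, a fact
  -- that the first alternative of `split` would forget.
  split-step : ∀ {k} w → toℕ w ≡ k → ∀ {u x v d} → T (E u x) → toℕ x < suc k → Walk (suc k) x v d →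
    (toℕ x < k × Walk k x v d) ⊎ Through k w u v (ℓ u x + d)

  split w w≡k (edge e)     = inj₁ (edge e)
  split w w≡k (step e l p) with split-step w w≡k e l p
  ... | inj₁ (l′ , q) = inj₁ (step e l′ q)
  ... | inj₂ t        = inj₂ t

  split-step w refl {u} {x} {d = d} e l p with split w refl p | m<1+n⇒m<n∨m≡n l
  ... | inj₁ q | inj₁ x<k = inj₁ (x<k , q)
  ... | inj₂ (a , b , q , q′ , ab≤d) | inj₁ x<k =
    inj₂ (ℓ u x + a , b , step e x<k q , q′ ,
      subst (_≤ ℓ u x + d) (sym (+-assoc (ℓ u x) a b)) (+-monoʳ-≤ (ℓ u x) ab≤d))
  ... | inj₁ q | inj₂ x≡k with toℕ-injective x≡k
  ...   | refl = inj₂ (_ , _ , edge e , q , ≤-refl)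
  split-step w refl {u} {x} e l p | inj₂ (a , b , q , q′ , ab≤d) | inj₂ x≡k with toℕ-injective x≡k
  ...   | refl = inj₂ (_ , b , edge e , q′ , +-monoʳ-≤ (ℓ u x) (≤-trans (m≤n+m b a) ab≤d))

  Shortest : ℕ → Fin n → Fin n → Set
  Shortest k u v = (∀ d → ¬ Walk k u v d) ⊎ (∃[ d ] Walk k u v d × (∀ d′ → Walk k u v d′ → d ≤ d′))

  shortest : ∀ k → k ≤ n → ∀ u v → Shortest k u v
  shortest zero _ u v with E u v in eq
  ... | true  = inj₂ (_ , edge (subst T (sym eq) tt) , λ { _ (edge _) → ≤-refl ; _ (step _ () _) })
  ... | false = inj₁ λ { _ (edge e) → subst T eq e ; _ (step _ () _) }
  shortest (suc k) k<n u v =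
    extend (shortest k (<⇒≤ k<n) u v) (shortest k (<⇒≤ k<n) u w) (shortest k (<⇒≤ k<n) w v)
    where
    w = fromℕ< k<n
    w≡k : toℕ w ≡ k
    w≡k = toℕ-fromℕ< k<n

    join : ∀ {a b} → Walk k u w a → Walk k w v b → Walk (suc k) u v (a + b)
    join p q = walk-++ (walk-suc p) (s≤s (≤-reflexive w≡k)) (walk-suc q)

    direct : Shortest k u v → (∀ {d} → ¬ Through k w u v d) → Shortest (suc k) u v
    direct (inj₁ none) ¬t = inj₁ λ d p → [ none d , ¬t ]′ (split w w≡k p)
    direct (inj₂ (d , p , least)) ¬t =
      inj₂ (d , walk-suc p , λ d′ q → [ least d′ , (λ t → ⊥-elim (¬t t)) ]′ (split w w≡k q))

    extend : Shortest k u v → Shortest k u w → Shortest k w v → Shortest (suc k) u v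
    extend s (inj₁ none) _ = direct s λ (a , _ , p , _) → none a p
    extend s (inj₂ _) (inj₁ none) = direct s λ (_ , b , _ , q , _) → none b q
    extend s (inj₂ (a , p , a≤)) (inj₂ (b , q , b≤)) = compare s
      where
      via : ∀ {d} → Through k w u v d → a + b ≤ d
      via (a′ , b′ , p′ , q′ , ab≤d) = ≤-trans (+-mono-≤ (a≤ a′ p′) (b≤ b′ q′)) ab≤d

      compare : Shortest k u v → Shortest (suc k) u v
      compare (inj₁ none) =
        inj₂ (a + b , join p q , λ d′ r → [ (λ r′ → ⊥-elim (none d′ r′)) , via ]′ (split w w≡k r))
      compare (inj₂ (d , r , d≤)) with ≤-total d (a + b)
      ... | inj₁ d≤ab = inj₂ (d , walk-suc r , λ d′ r′ →
        [ d≤ d′ , (λ t → ≤-trans d≤ab (via t)) ]′ (split w w≡k r′))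
      ... | inj₂ ab≤d = inj₂ (a + b , join p q , λ d′ r′ →
        [ (λ r″ → ≤-trans ab≤d (d≤ d′ r″)) , via ]′ (split w w≡k r′))

  distance : ∀ s t → ∃[ d ] IsDist E ℓ s t d
  distance s t with s ≟ᶠ t
  ... | yes refl = just 0 , [] , λ _ _ → z≤n
  ... | no s≢t with shortest n ≤-refl s t
  ...   | inj₁ none = nothing , λ { _ [] → s≢t refl ; _ (e ∷ p) → none _ (edge∷path⇒walk e p) }
  ...   | inj₂ (d , p , least) =
    just d , walk⇒path p , λ { _ [] → ⊥-elim (s≢t refl) ; _ (e ∷ q) → least _ (edge∷path⇒walk e q) }

  Detour : Fin n → Fin n → Set
  Detour u v = ∃[ w ] Through n w u v (ℓ u v)

  -- The edges without detour form the least distance preserver.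
  record Irreducible (H : EdgeSet n) : Set where
    field
      sub      : H ⊑ E
      dropped  : ∀ u v → T (E u v) → ¬ T (H u v) → Detour u v
      required : ∀ u v → T (H u v) → ∀ w d → T (E u w) → Walk n w v d → ¬ (ℓ u w + d ≤ ℓ u v)

  path-mono : ∀ {H H′ : EdgeSet n} → H ⊑ H′ → ∀ {s t d} → Path H ℓ s t d → Path H′ ℓ s t d
  path-mono H⊑H′ []      = []
  path-mono H⊑H′ (e ∷ p) = H⊑H′ _ _ e ∷ path-mono H⊑H′ p

  path-++ : ∀ {H : EdgeSet n} {s u t d d′} → Path H ℓ s u d → Path H ℓ u t d′ → Path H ℓ s t (d + d′)
  path-++ [] q = q
  path-++ {d′ = d′} (_∷_ {s} {u} {d = d} e p) q =
    subst (Path _ ℓ _ _) (sym (+-assoc (ℓ s u) d d′)) (e ∷ path-++ p q)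

  module _ {H : EdgeSet n} (irr : Irreducible H) where
    open Irreducible irr

    private
      NoLonger : Fin n → Fin n → ℕ → Set
      NoLonger u v d = ∃[ d′ ] Path H ℓ u v d′ × d′ ≤ d

    -- Both parts of a detour of an edge are shorter than the edge.
    reroute : ∀ m {u v d} → d < m → Walk n u v d → NoLonger u v d
    reroute (suc m) (s≤s d≤m) (edge {u} {v} e) with H u v in eq
    ... | true = _ , subst T (sym eq) tt ∷ [] , ≤-reflexive (+-identityʳ _)
    ... | false with dropped u v e (subst T eq)
    ...   | w , a , b , p , q , ab≤ℓ
      with reroute m (≤-trans (≤-trans (m<m+n a (walk-positive q)) ab≤ℓ) d≤m) p
         | reroute m (≤-trans (≤-trans (m<n+m b (walk-positive p)) ab≤ℓ) d≤m) q
    ... | a′ , p′ , a′≤a | b′ , q′ , b′≤b =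
      a′ + b′ , path-++ p′ q′ , ≤-trans (+-mono-≤ a′≤a b′≤b) ab≤ℓ
    -- Lengths are positive, so the first edge and the rest are both strictly shorter than the whole
    -- walk, and the same bound `m` decreases in this case too.
    reroute (suc m) (s≤s d≤m) (step {u} {w} {d = d} e _ q)
      with reroute m (≤-trans (m<m+n (ℓ u w) (walk-positive q)) d≤m) (edge e)
         | reroute m (≤-trans (m<n+m d (ℓ≥1 u w e)) d≤m) q
    ... | a′ , p′ , a′≤a | b′ , q′ , b′≤b = a′ + b′ , path-++ p′ q′ , +-mono-≤ a′≤a b′≤b

    resolvesAll : ResolvesAll I H
    resolvesAll s t with distance s t
    ... | nothing , none = nothing , (λ d p → none d (path-mono sub p)) , none
    ... | just d , p , least with nolonger p
      where
      nolonger : ∀ {s t d} → Path E ℓ s t d → NoLonger s t d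
      nolonger []      = 0 , [] , z≤n
      nolonger (e ∷ p) = reroute _ ≤-refl (edge∷path⇒walk e p)
    ...   | d′ , p′ , d′≤d with ≤-antisym d′≤d (least d′ (path-mono sub p′))
    ...     | refl = just d , (p′ , λ d″ q → least d″ (path-mono sub q)) , p , least

    -- A shortest path of `H′` between the ends of an edge of `H` is no longer than that edge. It is
    -- not empty, as there are no loops, and with two or more edges it would contradict `required`;
    -- so it is the edge itself.
    least-preserver : ∀ {H′} → Feasible I H′ → H ⊑ H′
    least-preserver {H′} (H′⊑E , res) u v uv with res u v
    ... | nothing , _ , none = ⊥-elim (none _ (sub u v uv ∷ []))
    ... | just d , (p , _) , (_ , least) = single refl d≤ℓ p
      where
      d≤ℓ : d ≤ ℓ u v
      d≤ℓ = subst (d ≤_) (+-identityʳ _) (least _ (sub u v uv ∷ []))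
      single : ∀ {v′ d′} → v′ ≡ v → d′ ≤ ℓ u v → Path H′ ℓ u v′ d′ → T (H′ u v)
      single refl _   []           = ⊥-elim (loopless u (sub u u uv))
      single refl _   (e ∷ [])     = e
      single refl d≤ℓ (e ∷ (f ∷ p)) = ⊥-elim
        (required u v uv _ _ (H′⊑E _ _ e) (edge∷path⇒walk (H′⊑E _ _ f) (path-mono H′⊑E p)) d≤ℓ)

  -- In-place Floyd-Warshall relaxation of a matrix D, with B + 1 as ∞, so
  -- that entries stay polynomially bounded.  O u v = 0 records that D u v is
  -- not realized by the edge (u , v) alone.
  module Relaxation where

    B : ℕ
    B = ⟦ L ⟧ n

    Matrix : Set
    Matrix = Fin n → Fin n → ℕ

    -- `walk` stops at `B` because the entry `suc B` may stand for ∞. Nothing is lost: a detour of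
    -- an edge is no longer than the edge, hence at most `B`.
    record Sound (D O : Matrix) : Set where
      field
        capped   : ∀ u v → D u v ≤ suc B
        positive : ∀ u v → 1 ≤ D u v
        walk     : ∀ u v → D u v ≤ B → Walk n u v (D u v)
        D≤ℓ      : ∀ u v → T (E u v) → D u v ≤ ℓ u v
        kept     : ∀ u v → O u v ≢ 0 → T (E u v) × D u v ≡ ℓ u v
        dropped  : ∀ u v → T (E u v) → O u v ≡ 0 → Detour u v

    -- The guarantee against a walk of length `d` with at least two edges. A tie with `O u v`
    -- nonzero is excluded, since it would leave a redundant edge in the output.
    Beats : Matrix → Matrix → Fin n → Fin n → ℕ → Set
    Beats D O u v d = D u v < d ⊎ (D u v ≤ d × O u v ≡ 0)

    Complete : ℕ → Matrix → Matrix → Set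
    Complete k D O = ∀ u v {w d} → T (E u w) → toℕ w < k → Walk k w v d → Beats D O u v (ℓ u w + d)

    complete⇒≤ : ∀ {k D O u v d} → Sound D O → Complete k D O → Walk k u v d → D u v ≤ d
    complete⇒≤ s c (edge e) = Sound.D≤ℓ s _ _ e
    complete⇒≤ s c (step e l p) = [ <⇒≤ , proj₁ ]′ (c _ _ e l p)

    -- The effect of visiting one cell, stated for matrices, so that the invariants can be treated
    -- without reference to memories.
    record Relaxed (w u v : Fin n) (D O D′ O′ : Matrix) : Set where
      field
        change : ∀ p q → (D′ p q ≡ D p q × O′ p q ≡ O p q) ⊎
          (p ≡ u × q ≡ v × D u w + D w v ≤ D u v × D′ p q ≡ D u w + D w v × O′ p q ≡ 0)
        hit : D u w + D w v ≤ D u v → D′ u v ≡ D u w + D w v × O′ u v ≡ 0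

    module _ {w u v D O D′ O′} (s : Sound D O) (r : Relaxed w u v D O D′ O′) where
      open Sound s
      open Relaxed r

      relaxed-≤ : ∀ p q → D′ p q ≤ D p q
      relaxed-≤ p q with change p q
      ... | inj₁ (D′≡ , _) = ≤-reflexive D′≡
      ... | inj₂ (refl , refl , ≤D , D′≡ , _) = ≤-trans (≤-reflexive D′≡) ≤D

      private
        module _ (≤1+B : D u w + D w v ≤ suc B) where
          -- The other summand is at least 1. So even a sum equal to `suc B`, the value of ∞, has
          -- two summands that are lengths of actual walks.
          left≤B : D u w ≤ B
          left≤B = ≤-pred (≤-trans (m<m+n (D u w) (positive w v)) ≤1+B)

          right≤B : D w v ≤ B
          right≤B = ≤-pred (≤-trans (m<n+m (D w v) (positive u w)) ≤1+B)

      relaxed-sound : Sound D′ O′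
      relaxed-sound .Sound.capped p q = ≤-trans (relaxed-≤ p q) (capped p q)
      relaxed-sound .Sound.positive p q with change p q
      ... | inj₁ (D′≡ , _) rewrite D′≡ = positive p q
      ... | inj₂ (_ , _ , _ , D′≡ , _) rewrite D′≡ = ≤-trans (positive u w) (m≤m+n _ _)
      relaxed-sound .Sound.walk p q D′≤B with change p q
      ... | inj₁ (D′≡ , _) rewrite D′≡ = walk p q D′≤B
      ... | inj₂ (refl , refl , _ , D′≡ , _) rewrite D′≡ =
        walk-++ (walk u w (left≤B (m≤n⇒m≤1+n D′≤B))) (toℕ<n w) (walk w v (right≤B (m≤n⇒m≤1+n D′≤B)))
      relaxed-sound .Sound.D≤ℓ p q e = ≤-trans (relaxed-≤ p q) (D≤ℓ p q e)
      relaxed-sound .Sound.kept p q O′≢0 with change p q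
      ... | inj₁ (D′≡ , O′≡) rewrite D′≡ | O′≡ = kept p q O′≢0
      ... | inj₂ (_ , _ , _ , _ , O′≡0) = ⊥-elim (O′≢0 O′≡0)
      relaxed-sound .Sound.dropped p q e O′≡0 with change p q
      ... | inj₁ (_ , O′≡) = dropped p q e (trans (sym O′≡) O′≡0)
      ... | inj₂ (refl , refl , ≤D , _ , _) =
        w , _ , _ , walk u w (left≤B ≤1+B) , walk w v (right≤B ≤1+B) , ≤-trans ≤D (D≤ℓ u v e)
        where
        ≤1+B : D u w + D w v ≤ suc B
        ≤1+B = ≤-trans ≤D (capped u v)

      relaxed-beats : ∀ {p q d} → Beats D O p q d → Beats D′ O′ p q d
      relaxed-beats {p} {q} b with change p q
      ... | inj₁ (D′≡ , O′≡) rewrite D′≡ | O′≡ = b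
      ... | inj₂ (refl , refl , ≤D , D′≡ , O′≡0) =
        inj₂ (≤-trans (relaxed-≤ u v) ([ <⇒≤ , proj₁ ]′ b) , O′≡0)

      relaxed-complete : ∀ {k} → Complete k D O → Complete k D′ O′
      relaxed-complete c p q e l x = relaxed-beats (c p q e l x)

      -- By completeness the sum `D u w + D w v` is at most `d`. The two outcomes of the test yield
      -- the two alternatives of `Beats`: if it fails, `D u v` is strictly below the sum; if it
      -- succeeds, the flag is cleared.
      relaxed-through : ∀ {k d} → Complete k D O → Through k w u v d → Beats D′ O′ u v d
      relaxed-through {d = d} c (a , b , p , q , ab≤d) = go (<-≤-connex (D u v) (D u w + D w v))
        where
        via≤d : D u w + D w v ≤ d
        via≤d = ≤-trans (+-mono-≤ (complete⇒≤ s c p) (complete⇒≤ s c q)) ab≤d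

        go : D u v < D u w + D w v ⊎ D u w + D w v ≤ D u v → Beats D′ O′ u v d
        go (inj₁ D<) = inj₁ (≤-trans (s≤s (relaxed-≤ u v)) (≤-trans D< via≤d))
        go (inj₂ ≤D) with hit ≤D
        ... | D′≡ , O′≡0 = inj₂ (≤-trans (≤-reflexive D′≡) via≤d , O′≡0)

    irreducible : ∀ {D O} → Sound D O → Complete n D O → Irreducible (λ u v → 0 <ᵇ O u v)
    irreducible {D} {O} s c = record
      { sub      = λ u v h → proj₁ (kept u v (positive≢0 h))
      ; dropped  = λ u v e ¬h → dropped u v e (zero≡ ¬h)
      ; required = λ u v h w d e p le → beaten (positive≢0 h) le (c u v e (toℕ<n w) p)
      }
      where
      open Sound s
      positive≢0 : ∀ {x} → T (0 <ᵇ x) → x ≢ 0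
      positive≢0 {suc x} _ ()
      zero≡ : ∀ {x} → ¬ T (0 <ᵇ x) → x ≡ 0
      zero≡ {zero}  _  = refl
      zero≡ {suc x} ¬h = ⊥-elim (¬h tt)
      beaten : ∀ {u v d} → O u v ≢ 0 → d ≤ ℓ u v → ¬ Beats D O u v d
      beaten {u} {v} O≢0 d≤ℓ (inj₁ D<d) =
        <-irrefl (proj₂ (kept u v O≢0)) (≤-trans D<d d≤ℓ)
      beaten O≢0 d≤ℓ (inj₂ (_ , O≡0)) = O≢0 O≡0

-- The algorithm

at : ℕ → ℕ → Expr
at x y = 0 ⟨ lit 0 ⟩ ⊗ x ⟨ lit 0 ⟩ ⊕ y ⟨ lit 0 ⟩

horner : Poly → Expr
horner []      = lit 0
horner (a ∷ p) = lit a ⊕ 0 ⟨ lit 0 ⟩ ⊗ horner p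

eval-horner : ∀ σ p → eval σ (horner p) ≡ ⟦ p ⟧ (σ 0 0)
eval-horner σ []      = refl
eval-horner σ (a ∷ p) = cong (λ y → a + σ 0 0 * y) (eval-horner σ p)

reads-horner : ∀ p → Reads (horner p)
reads-horner []      = tt
reads-horner (a ∷ p) = _ , _ , reads-horner p

-- Array 8 holds `D`, and the output array 4 holds `O`, which starts as the length matrix since that
-- is nonzero exactly on the edges. Cell 0 of arrays 5, 6 and 7 contains the pivot, the row and the
-- column.
initialCell : Poly → Cmd
initialCell L =
  (4 ⟨ at 6 7 ⟩≔ 1 ⟨ at 6 7 ⟩) ⨾
  (if′ 1 ⟨ at 6 7 ⟩
    then (8 ⟨ at 6 7 ⟩≔ 1 ⟨ at 6 7 ⟩)
    else (8 ⟨ at 6 7 ⟩≔ lit 1 ⊕ horner L))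

relax : Cmd
relax =
  if′ 8 ⟨ at 6 5 ⟩ ⊕ 8 ⟨ at 5 7 ⟩ ⊴ 8 ⟨ at 6 7 ⟩
    then ((8 ⟨ at 6 7 ⟩≔ 8 ⟨ at 6 5 ⟩ ⊕ 8 ⟨ at 5 7 ⟩) ⨾ (4 ⟨ at 6 7 ⟩≔ lit 0))
    else skip

preserver : Poly → Cmd
preserver L =
  (for 6 loop for 7 loop initialCell L) ⨾
  (for 5 loop for 6 loop for 7 loop relax)

-- By injectivity of `combine`, a write to the cell of (u , v) affects no other cell of the matrix.
write-entry : ∀ {n} (f : ℕ → ℕ) (u v p q : Fin n) x →
  let y = if toℕ (combine u v) ≡ᵇ toℕ (combine p q) then x else f (toℕ (combine p q)) in
  (p ≡ u × q ≡ v × y ≡ x) ⊎ y ≡ f (toℕ (combine p q))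
write-entry f u v p q x
  with toℕ (combine u v) ≡ᵇ toℕ (combine p q) | ≡ᵇ⇒≡ (toℕ (combine u v)) (toℕ (combine p q))
... | false | _  = inj₂ refl
... | true  | eq with combine-injective u v p q (toℕ-injective (eq tt))
...   | refl , refl = inj₁ (refl , refl , refl)

-- Correctness of the program

module Correctness {L : Poly} {n : ℕ} (I : Instance L n) where
  open Instance I
  open Distances I
  open Relaxation

  -- Large enough for the loop counters, which reach `n`, and for the matrix entries, which reach
  -- `suc B`.
  V : ℕ
  V = n + suc B

  n≤V : n ≤ V
  n≤V = m≤m+n n (suc B)

  1+B≤V : suc B ≤ V
  1+B≤V = m≤n+m (suc B) n

  open Logic n V n≤V

  entry : ℕ → Mem → Matrix
  entry a σ u v = σ a (toℕ (combine u v))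

  eval-at : ∀ {σ x y} {u v : Fin n} → Valid σ → σ x 0 ≡ toℕ u → σ y 0 ≡ toℕ v →
    eval σ (at x y) ≡ toℕ (combine u v)
  eval-at {σ} {u = u} {v} vσ ≡u ≡v = begin
    σ 0 0 * σ _ 0 + σ _ 0   ≡⟨ cong₂ _+_ (cong₂ _*_ (Valid.order vσ) ≡u) ≡v ⟩
    n * toℕ u + toℕ v       ≡⟨ sym (toℕ-combine u v) ⟩
    toℕ (combine u v)       ∎
    where open ≡-Reasoning

  initial : Matrix
  initial u v = if E u v then ℓ u v else suc B

  Initialized : Fin n → Fin n → Mem → Set
  Initialized u v σ = entry 4 σ u v ≡ inLength I u v × entry 8 σ u v ≡ initial u v

  InputLengths : Mem → Set
  InputLengths σ = ∀ u v → entry 1 σ u v ≡ inLength I u v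

  initial≡inLength : ∀ u v → NonZero (inLength I u v) → initial u v ≡ inLength I u v
  initial≡inLength u v nz with E u v
  ... | true = refl

  initial≡1+B : ∀ u v → inLength I u v ≡ 0 → initial u v ≡ suc B
  initial≡1+B u v ≡0 with E u v | ℓ≥1 u v
  ... | true  | ℓ≥1 with subst (1 ≤_) ≡0 (ℓ≥1 tt)
  ...   | ()
  initial≡1+B u v ≡0 | false | _ = refl

  inLength≤B : ∀ u v → inLength I u v ≤ B
  inLength≤B u v with E u v | ℓ≤poly u v
  ... | true  | ℓ≤ = ℓ≤ tt
  ... | false | _  = z≤n

  initial-sound : Sound initial (inLength I)
  initial-sound = record
    { capped   = λ u v → capped u v
    ; positive = λ u v → positive u v
    ; walk     = λ u v → walk u v
    ; D≤ℓ      = λ u v → D≤ℓ u v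
    ; kept     = λ u v → kept u v
    ; dropped  = λ u v → dropped u v
    }
    where
    capped : ∀ u v → initial u v ≤ suc B
    capped u v with E u v | ℓ≤poly u v
    ... | true  | ℓ≤ = m≤n⇒m≤1+n (ℓ≤ tt)
    ... | false | _  = ≤-refl
    positive : ∀ u v → 1 ≤ initial u v
    positive u v with E u v | ℓ≥1 u v
    ... | true  | 1≤ = 1≤ tt
    ... | false | _  = s≤s z≤n
    walk : ∀ u v → initial u v ≤ B → Walk n u v (initial u v)
    walk u v ≤B with E u v in eq
    ... | true  = edge (subst T (sym eq) tt)
    ... | false = ⊥-elim (<-irrefl refl ≤B)
    D≤ℓ : ∀ u v → T (E u v) → initial u v ≤ ℓ u v
    D≤ℓ u v e with E u v
    ... | true = ≤-refl
    kept : ∀ u v → inLength I u v ≢ 0 → T (E u v) × initial u v ≡ ℓ u v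
    kept u v ≢0 with E u v
    ... | true  = tt , refl
    ... | false = ⊥-elim (≢0 refl)
    dropped : ∀ u v → T (E u v) → inLength I u v ≡ 0 → Detour u v
    dropped u v e ≡0 with E u v | ℓ≥1 u v
    ... | true | 1≤ with subst (1 ≤_) ≡0 (1≤ tt)
    ...   | ()

  -- The matrices in memory agree with the initial ones only pointwise, so soundness is transported
  -- field by field instead of by function extensionality.
  sound-cong : ∀ {D O D′ O′} → (∀ u v → O′ u v ≡ O u v × D′ u v ≡ D u v) → Sound D O → Sound D′ O′
  sound-cong {D} {O} {D′} {O′} eq s = record
    { capped   = λ u v → subst (_≤ suc B) (D≡ u v) (capped u v)
    ; positive = λ u v → subst (1 ≤_) (D≡ u v) (positive u v)
    ; walk     = λ u v ≤B → subst (Walk n u v) (D≡ u v) (walk u v (subst (_≤ B) (sym (D≡ u v)) ≤B))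
    ; D≤ℓ      = λ u v e → subst (_≤ ℓ u v) (D≡ u v) (D≤ℓ u v e)
    ; kept     = λ u v ≢0 → let e , ≡ℓ = kept u v (λ ≡0 → ≢0 (trans (proj₁ (eq u v)) ≡0)) in
                            e , trans (proj₂ (eq u v)) ≡ℓ
    ; dropped  = λ u v e ≡0 → dropped u v e (trans (sym (proj₁ (eq u v))) ≡0)
    }
    where
    open Sound s
    D≡ : ∀ u v → D u v ≡ D′ u v
    D≡ u v = sym (proj₂ (eq u v))

  initialize : ∀ {σ} → Valid σ → InputLengths σ →
    WP (for 6 loop for 7 loop initialCell L) σ λ σ′ → InputLengths σ′ × ∀ u v → Initialized u v σ′
  initialize = wp-for² InputLengths Initialized (λ g → g) (λ g → g) (λ q → q) (λ q → q) cell
    where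
    module _ (u v : Fin n) {σ : Mem} (vσ : Valid σ) (lengths : InputLengths σ)
      (≡u : σ 6 0 ≡ toℕ u) (≡v : σ 7 0 ≡ toℕ v) where

      here : eval σ (at 6 7) ≡ toℕ (combine u v)
      here = eval-at vσ ≡u ≡v

      length≡ : eval σ (1 ⟨ at 6 7 ⟩) ≡ inLength I u v
      length≡ = trans (cong (σ 1) here) (lengths u v)

      length≤V : eval σ (1 ⟨ at 6 7 ⟩) ≤ V
      length≤V = Valid.bound vσ 1 _ _

      post : ∀ {x y} → x ≡ inLength I u v → y ≡ initial u v →
        let i  = eval σ (at 6 7)
            σ′ = σ [ 4 , i ≔ x ] [ 8 , i ≔ y ] in
        InputLengths σ′ × σ′ 6 0 ≡ toℕ u × σ′ 7 0 ≡ toℕ v ×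
        (∀ p q → Initialized p q σ → Initialized p q σ′) × Initialized u v σ′
      post {x} {y} x≡ y≡ rewrite here = lengths , ≡u , ≡v , keep ,
        trans (read-same σ 4 uv x) x≡ , trans (read-same σ 8 uv y) y≡
        where
        uv = toℕ (combine u v)
        keep : ∀ p q → Initialized p q σ → Initialized p q (σ [ 4 , uv ≔ x ] [ 8 , uv ≔ y ])
        keep p q (init₄ , init₈) with write-entry (σ 4) u v p q x | write-entry (σ 8) u v p q y
        ... | inj₁ (refl , refl , ≡x) | inj₁ (_ , _ , ≡y) = trans ≡x x≡ , trans ≡y y≡
        -- Both writes use the same index, so this case and the next do not arise. `write-entry`
        -- does not reveal that, but the claim holds in them anyway.
        ... | inj₁ (refl , refl , ≡x) | inj₂ ≡8 = trans ≡x x≡ , trans ≡8 init₈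
        ... | inj₂ ≡4 | inj₁ (refl , refl , ≡y) = trans ≡4 init₄ , trans ≡y y≡
        ... | inj₂ ≡4 | inj₂ ≡8 = trans ≡4 init₄ , trans ≡8 init₈

      cell : WP (initialCell L) σ λ σ′ → InputLengths σ′ × σ′ 6 0 ≡ toℕ u × σ′ 7 0 ≡ toℕ v ×
        (∀ p q → Initialized p q σ → Initialized p q σ′) × Initialized u v σ′
      cell = wp-seq
        (wp-assign {Q = λ σ′ → σ′ ≡ σ [ 4 , eval σ (at 6 7) ≔ eval σ (1 ⟨ at 6 7 ⟩) ]}
          3 (at 6 7) (1 ⟨ at 6 7 ⟩) vσ _ _ length≤V refl)
        λ { v′ refl → wp-if (1 ⟨ at 6 7 ⟩) v′ _
          (λ nz → wp-assign 7 (at 6 7) (1 ⟨ at 6 7 ⟩) v′ _ _ length≤V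
            (post length≡ (trans length≡ (sym (initial≡inLength u v (subst NonZero length≡ nz))))))
          (λ ≡0 → wp-assign 7 (at 6 7) (lit 1 ⊕ horner L) v′ _ (_ , reads-horner L)
            (≤-trans (≤-reflexive (infinity v′)) 1+B≤V)
            (post length≡ (trans (infinity v′)
              (sym (initial≡1+B u v (trans (sym length≡) ≡0)))))) }
        where
        infinity : ∀ {σ} → Valid σ → eval σ (lit 1 ⊕ horner L) ≡ suc B
        infinity {σ} v = cong suc (trans (eval-horner σ L) (cong ⟦ L ⟧ (Valid.order v)))

  State : ℕ → Mem → Set
  State k σ = Sound (entry 8 σ) (entry 4 σ) × Complete k (entry 8 σ) (entry 4 σ)

  module Phase (w : Fin n) where

    -- Completeness below the pivot is preserved by every single relaxation. Each cell of the phase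
    -- can rely on it whichever cells were visited before, so updating in place is harmless.
    Pivot : Mem → Set
    Pivot σ = σ 5 0 ≡ toℕ w × State (toℕ w) σ

    Finished : Fin n → Fin n → Mem → Set
    Finished u v σ = ∀ {x d} → T (E u x) → toℕ x < suc (toℕ w) → Walk (suc (toℕ w)) x v d →
      Beats (entry 8 σ) (entry 4 σ) u v (ℓ u x + d)

    module _ (u v : Fin n) {σ : Mem} (vσ : Valid σ) (pivot : Pivot σ)
      (≡u : σ 6 0 ≡ toℕ u) (≡v : σ 7 0 ≡ toℕ v) where

      private
        D = entry 8 σ
        s = D u w + D w v

        uw : eval σ (at 6 5) ≡ toℕ (combine u w)
        uw = eval-at vσ ≡u (proj₁ pivot)
        wv : eval σ (at 5 7) ≡ toℕ (combine w v)
        wv = eval-at vσ (proj₁ pivot) ≡v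
        uv : eval σ (at 6 7) ≡ toℕ (combine u v)
        uv = eval-at vσ ≡u ≡v

        sum≡ : eval σ (8 ⟨ at 6 5 ⟩ ⊕ 8 ⟨ at 5 7 ⟩) ≡ s
        sum≡ = cong₂ (λ i j → σ 8 i + σ 8 j) uw wv

        target≡ : eval σ (8 ⟨ at 6 7 ⟩) ≡ D u v
        target≡ = cong (σ 8) uv

      Relaxes : Mem → Set
      Relaxes σ′ = σ′ 5 0 ≡ toℕ w × σ′ 6 0 ≡ toℕ u × σ′ 7 0 ≡ toℕ v ×
        Relaxed w u v D (entry 4 σ) (entry 8 σ′) (entry 4 σ′)

      relaxes : WP relax σ Relaxes
      relaxes = wp-if (8 ⟨ at 6 5 ⟩ ⊕ 8 ⟨ at 5 7 ⟩ ⊴ 8 ⟨ at 6 7 ⟩) vσ _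
        (λ nz → shorter (subst₂ _≤_ sum≡ target≡
          (nonZero-⊴ σ (8 ⟨ at 6 5 ⟩ ⊕ 8 ⟨ at 5 7 ⟩) (8 ⟨ at 6 7 ⟩) nz)))
        (λ ≡0 → wp-skip vσ (proj₁ pivot , ≡u , ≡v , record
          { change = λ _ _ → inj₁ (refl , refl)
          ; hit    = λ ≤D → ⊥-elim (<⇒≱ (subst₂ _<_ target≡ sum≡
              (zero-⊴ σ (8 ⟨ at 6 5 ⟩ ⊕ 8 ⟨ at 5 7 ⟩) (8 ⟨ at 6 7 ⟩) ≡0)) ≤D)
          }))
        where
        updated : s ≤ D u v → ∀ {i x} → i ≡ toℕ (combine u v) → x ≡ s →
          Relaxes (σ [ 8 , i ≔ x ] [ 4 , i ≔ 0 ])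
        updated ≤D refl refl = proj₁ pivot , ≡u , ≡v , record
          { change = change
          ; hit    = λ _ → read-same σ 8 (toℕ (combine u v)) s , read-same σ 4 (toℕ (combine u v)) 0
          }
          where
          change : ∀ p q → _
          change p q with write-entry (σ 8) u v p q s | write-entry (σ 4) u v p q 0
          ... | inj₁ (p≡u , q≡v , ≡s) | inj₁ (_ , _ , ≡0) = inj₂ (p≡u , q≡v , ≤D , ≡s , ≡0)
          ... | inj₁ (refl , refl , ≡s) | inj₂ _ =
            inj₂ (refl , refl , ≤D , ≡s , read-same σ 4 (toℕ (combine u v)) 0)
          ... | inj₂ _ | inj₁ (refl , refl , ≡0) =
            inj₂ (refl , refl , ≤D , read-same σ 8 (toℕ (combine u v)) s , ≡0)
          ... | inj₂ ≡8 | inj₂ ≡4 = inj₁ (≡8 , ≡4)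

        shorter : s ≤ D u v →
          WP ((8 ⟨ at 6 7 ⟩≔ 8 ⟨ at 6 5 ⟩ ⊕ 8 ⟨ at 5 7 ⟩) ⨾ (4 ⟨ at 6 7 ⟩≔ lit 0)) σ Relaxes
        shorter ≤D = wp-seq
          (wp-assign {Q = λ σ′ → σ′ ≡ σ [ 8 , eval σ (at 6 7) ≔ eval σ (8 ⟨ at 6 5 ⟩ ⊕ 8 ⟨ at 5 7 ⟩) ]}
            7 (at 6 7) (8 ⟨ at 6 5 ⟩ ⊕ 8 ⟨ at 5 7 ⟩) vσ _ _
            (≤-trans (≤-reflexive sum≡) (≤-trans ≤D (Valid.bound vσ 8 _ _))) refl)
          λ { v′ refl → wp-assign 3 (at 6 7) (lit 0) v′ _ _ z≤n (updated ≤D uv sum≡) }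

      cell : WP relax σ λ σ′ → Pivot σ′ × σ′ 6 0 ≡ toℕ u × σ′ 7 0 ≡ toℕ v ×
        (∀ p q → Finished p q σ → Finished p q σ′) × Finished u v σ′
      cell = wp-mono
        (λ (≡w , ≡u′ , ≡v′ , r) →
          (≡w , relaxed-sound sound r , relaxed-complete sound r complete) , ≡u′ , ≡v′ ,
          (λ p q fin e l x → relaxed-beats sound r (fin e l x)) ,
          λ e l x → [ (λ (l′ , x′) → relaxed-beats sound r (complete u v e l′ x′)) ,
                      relaxed-through sound r complete ]′ (split-step w refl e l x))
        relaxes
        where
        sound    = proj₁ (proj₂ pivot)
        complete = proj₂ (proj₂ pivot)

    phase : ∀ {σ} → Valid σ → State (toℕ w) σ → σ 5 0 ≡ toℕ w →
      WP (for 6 loop for 7 loop relax) σ λ σ′ → State (suc (toℕ w)) σ′ × σ′ 5 0 ≡ toℕ w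
    phase v state ≡w = wp-mono
      (λ ((≡w′ , sound , _) , fin) → (sound , λ p q → fin p q) , ≡w′)
      (wp-for² Pivot Finished (λ g → g) (λ g → g) (λ q → q) (λ q → q) cell v (≡w , state))

  -- The input memory and the whole execution

  rowMajor-combine : ∀ (f : Matrix) u v → rowMajor f (toℕ (combine u v)) ≡ f u v
  rowMajor-combine f u v with toℕ (combine u v) <? n * n
  ... | yes l = cong (uncurry f)
    (trans (cong (remQuot n) (fromℕ<-toℕ (combine u v) l)) (remQuot-combine u v))
  ... | no ¬l = ⊥-elim (¬l (toℕ<n (combine u v)))

  rowMajor-≤ : ∀ {f b} → (∀ u v → f u v ≤ b) → ∀ i → rowMajor {n} f i ≤ b
  rowMajor-≤ f≤ i with i <? n * n
  ... | yes l = f≤ _ _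
  ... | no _  = z≤n

  valid-input : Valid (input I)
  valid-input = valid refl bound
    where
    bound : ∀ a i → Bounded a → input I a i ≤ V
    bound 0 zero    _ = n≤V
    bound 0 (suc i) _ = z≤n
    bound 1 i       _ = ≤-trans (rowMajor-≤ inLength≤B i) (≤-trans (n≤1+n B) 1+B≤V)
    bound (suc (suc (suc (suc a)))) i _ = z≤n

  execution : WP (preserver L) (input I) (State n)
  execution = wp-seq (initialize valid-input λ u v → rowMajor-combine (inLength I) u v)
    λ v (_ , init) → wp-for 4 _ State (λ s → s)
      (λ w v′ state ≡w → Phase.phase w v′ state ≡w)
      -- A walk with at least two edges has an interior vertex, and none lies below 0: `Complete 0`
      -- is vacuous.
      v (sound-cong init initial-sound , λ _ _ _ ())

  result-irreducible : Irreducible (output n (Logic.Reaches.final execution))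
  result-irreducible = irreducible (proj₁ (Reaches.post execution)) (proj₂ (Reaches.post execution))

-- Sums, probabilities and growth of the ratio

sum-mono-ℚ : ∀ {n} {f g : Fin n → ℚ} → (∀ i → f i ℚ.≤ g i) →
  sum ℚ.+-0-rawMonoid f ℚ.≤ sum ℚ.+-0-rawMonoid g
sum-mono-ℚ {zero}  f≤g = ℚₚ.≤-refl
sum-mono-ℚ {suc n} f≤g = ℚₚ.+-mono-≤ (f≤g zero) (sum-mono-ℚ λ i → f≤g (suc i))

-- Costs are known to be nonnegative on `E` only, hence the condition on `H′`.
cost-mono : ∀ {L n} (I : Instance L n) {H H′} → H ⊑ H′ → H′ ⊑ Instance.E I → cost I H ℚ.≤ cost I H′
cost-mono I {H} {H′} H⊑H′ H′⊑E = sum-mono-ℚ λ u → sum-mono-ℚ λ v → entry u v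
  where
  open Instance I
  entry : ∀ u v → (if H u v then c u v else ℚ.0ℚ) ℚ.≤ (if H′ u v then c u v else ℚ.0ℚ)
  entry u v with H u v | H′ u v | H⊑H′ u v | H′⊑E u v
  ... | true  | true  | _  | _ = ℚₚ.≤-refl
  ... | true  | false | im | _ = ⊥-elim (im tt)
  ... | false | true  | _  | e = c≥0 u v (e tt)
  ... | false | false | _  | _ = ℚₚ.≤-refl

n≤sum : ∀ {n} (f : Fin n → ℕ) → (∀ i → 1 ≤ f i) → n ≤ sum +-0-rawMonoid f
n≤sum {zero}  f 1≤f = z≤n
n≤sum {suc n} f 1≤f = +-mono-≤ (1≤f zero) (n≤sum (λ i → f (suc i)) λ i → 1≤f (suc i))

-- Every matrix entry takes at least one bit. This turns the time bound, a polynomial in `n`, into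
-- one in the input size.
n≤size : ∀ {L n} (I : Instance L n) → n ≤ size I
n≤size {n = n} I = ≤-trans (n≤sum _ row) (m≤n+m _ (bits n))
  where
  row : ∀ u → 1 ≤ sum +-0-rawMonoid λ v → bits (inLength I u v) + bits (inNum I u v) + bits (inDen I u v)
  row u = ≤-trans (≤-trans (s≤s z≤n) (toℕ<n u)) (n≤sum _ λ v → s≤s z≤n)

1≤k/d : ∀ k d .{{_ : NonZero d}} → d ≤ k → 1ℚ ℚ.≤ + k ℚ./ d
1≤k/d k (suc d) d≤k = ℚₚ.toℚᵘ-cancel-≤ (ℚᵘₚ.≤-respʳ-≃
  (ℚᵘₚ.≃-sym (ℚₚ.toℚᵘ-fromℚᵘ (ℚᵘ.mkℚᵘ (+ k) d)))
  (ℚᵘ.*≤* (subst₂ ℤ._≤_ (sym (ℤₚ.*-identityˡ _)) (sym (ℤₚ.*-identityʳ _)) (ℤ.+≤+ d≤k))))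

1-1/n≤1 : ∀ n .{{_ : NonZero n}} → 1ℚ ℚ.- + 1 ℚ./ n ℚ.≤ 1ℚ
1-1/n≤1 n = ℚₚ.≤-trans
  (ℚₚ.+-monoʳ-≤ 1ℚ (ℚₚ.neg-antimono-≤ (ℚₚ.nonNegative⁻¹ (+ 1 ℚ./ n) {{ℚₚ.normalize-nonNeg 1 n}})))
  (ℚₚ.≤-reflexive (ℚₚ.+-identityʳ 1ℚ))

outcomes : ∀ m → List (Vec Bool m)
outcomes zero    = [] ∷ []
outcomes (suc m) = map (true ∷_) (outcomes m) ++ map (false ∷_) (outcomes m)

length-outcomes : ∀ m → length (outcomes m) ≡ 2 ^ m
length-outcomes zero    = refl
length-outcomes (suc m) = begin
  length (map (true ∷_) xs ++ map (false ∷_) xs)          ≡⟨ length-++ (map (true ∷_) xs) ⟩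
  length (map (true ∷_) xs) + length (map (false ∷_) xs)  ≡⟨ cong₂ _+_ (length-map _ xs) (length-map _ xs) ⟩
  length xs + length xs                                   ≡⟨ cong (λ l → l + l) (length-outcomes m) ⟩
  2 ^ m + 2 ^ m                                           ≡⟨ cong (_+_ (2 ^ m)) (sym (+-identityʳ (2 ^ m))) ⟩
  2 ^ suc m                                               ∎
  where
  open ≡-Reasoning
  xs = outcomes m

outcomes-unique : ∀ m → Unique (outcomes m)
outcomes-unique zero    = [] ∷ []
outcomes-unique (suc m) =
  ++⁺ (map⁺ ∷-injectiveʳ (outcomes-unique m)) (map⁺ ∷-injectiveʳ (outcomes-unique m)) disjoint
  where
  disjoint : ∀ {v} → ¬ (v ∈ map (true ∷_) (outcomes m) × v ∈ map (false ∷_) (outcomes m))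
  disjoint (p , q) with ∈-map⁻ (true ∷_) p | ∈-map⁻ (false ∷_) q
  ... | _ , _ , refl | _ , _ , ()

prob-certain : ∀ m {q} {A : Vec Bool m → Set} → q ℚ.≤ 1ℚ → (∀ r → A r) → ProbAtLeast m q A
prob-certain m q≤1 a = outcomes m , outcomes-unique m , universal a (outcomes m) ,
  ℚₚ.≤-trans q≤1 (1≤k/d _ (2 ^ m) {{m^n≢0 2 m}} (≤-reflexive (sym (length-outcomes m))))

1^ℚ : ∀ b → 1ℚ ^ℚ b ≡ 1ℚ
1^ℚ zero    = refl
1^ℚ (suc b) = trans (ℚₚ.*-identityˡ _) (1^ℚ b)

constant-Õ : ∀ r → Õ[n^ r ] (λ _ → 1ℚ)
-- Exponent 0 makes the logarithmic factor 1 even at `n = 1`, where the logarithm vanishes. The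
-- threshold 1 excludes `n = 0`, where the power of `n` may vanish.
constant-Õ r = 1 , 0 , 1 , λ n 1≤n → ℚₚ.nonNegative⁻¹ 1ℚ ,
  ℚₚ.≤-trans (ℚₚ.≤-reflexive (1^ℚ (ℚ.↧ₙ r)))
    (1≤k/d (1 ^ ℚ.↧ₙ r * n ^ ℤ.∣ ℚ.↥ r ∣) 1 (*-mono-≤ (≤-reflexive (sym (^-zeroˡ (ℚ.↧ₙ r))))
                         (m^n>0 n {{>-nonZero 1≤n}} ℤ.∣ ℚ.↥ r ∣)))

-- Assembling the algorithm and its guarantees

timePoly : ∀ L → PolyBounded (λ n → Bound.cmdTime (n + suc (⟦ L ⟧ n)) (preserver L))
timePoly L = cmdTime-bounded (id-bounded +ᵇ suc-bounded (poly-bounded L)) (preserver L)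

algorithm : ∀ L → WHPApproxAlgorithm L (λ _ → 1ℚ)
algorithm L = record
  { program   = preserver L
  ; timeBound = proj₁ (timePoly L)
  ; run       = λ I r → record { exec = Execution.exec I (toList r) }
  ; polytime  = λ {n} I r → ≤-trans (Execution.time≤ I)
      (≤-trans (proj₂ (timePoly L) n) (⟦⟧-mono-≤ (proj₁ (timePoly L)) (n≤size I)))
  ; subgraph  = λ I r → Distances.Irreducible.sub (irreducible I)
  ; ratio     = λ I r H* (feasible , _) → ℚₚ.≤-trans
      (cost-mono I (Distances.least-preserver I (irreducible I) feasible) (proj₁ feasible))
      (ℚₚ.≤-reflexive (sym (ℚₚ.*-identityˡ _)))
  ; success   = λ {n} I → prob-certain _ (1-1/n≤1 n)
      λ _ → Distances.resolvesAll I (irreducible I)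
  }
  where
  module Execution {n} (I : Instance L n) = Logic.Reaches (Correctness.execution I)
  irreducible : ∀ {n} (I : Instance L n) → _
  irreducible I = Correctness.result-irreducible I

theorem1p4 : (L : Poly) (ε : ℚ) → Positive ε →
    Σ (ℕ → ℚ) λ ρ → Õ[n^ ½ ℚ.+ ε ] ρ × WHPApproxAlgorithm L ρ
theorem1p4 L ε _ = (λ _ → 1ℚ) , constant-Õ (½ ℚ.+ ε) , algorithm L
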